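{- Let $n\ge 1$ and let $x_1,\dots,x_n$ be commuting indeterminates. Then $$\sum_{\pi \in \mathfrak{D}_n} (-1)^{\mathrm{inv}(\pi)}\, \mathbf{x}_{\mathrm{EXCi}(\pi)} = (-1)^{n-1} \sum_{j=1}^{n-1} x_{1}x_{2}\cdots x_{j}.$$
   Context: $[n]=\{1,\dots,n\}$; $\mathfrak{S}_n$ is the symmetric group on $[n]$; $\mathfrak{D}_n$ is the set of derangements, i.e. permutations $\pi\in\mathfrak{S}_n$ with $\pi(i)\ne i$ for all $i$. $\mathrm{inv}(\pi)$ is the number of pairs $i<j$ with $\pi(i)>\pi(j)$; $\mathrm{EXCi}(\pi)=\{j\in[n]:\pi(j)>j\}$; $\mathbf{x}_S=\prod_{s\in S}x_s$, with $\mathbf{x}_\emptyset=1$. -}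

module Defs where

open import Algebra.Bundles using (CommutativeRing; Semiring)
open import Data.Fin.Base using (Fin; _<_; _>_)
open import Data.Fin.Properties using (_≟_; _<?_; all?; any?)
open import Data.Fin.Subset using (Subset)
open import Data.Fin.Subset.Properties using (_∈?_)
open import Data.List.Base using (List; [_]; allFin; cartesianProduct; cartesianProductWith; filter; foldr; length; map)
open import Data.List.Membership.Propositional using (_∈_)
open import Data.List.Membership.Propositional.Properties using (∈-allFin; ∈-cartesianProductWith⁺; ∈-filter⁺)
open import Data.List.Relation.Unary.All using ([])
open import Data.List.Relation.Unary.AllPairs using ([]; _∷_)
open import Data.List.Relation.Unary.Any using (here)
open import Data.List.Relation.Unary.Unique.Propositional using (Unique)
open import Data.List.Relation.Unary.Unique.Propositional.Properties using (allFin⁺; cartesianProductWith⁺; filter⁺)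
open import Data.Nat.Base using (ℕ; zero; suc)
open import Data.Product.Base using (_×_; _,_; map₂)
open import Data.Vec.Base using (Vec; []; _∷_; lookup; tabulate)
open import Data.Vec.Properties using (∷-injective)
open import Function.Definitions using (Injective; Surjective; Bijective)
open import Relation.Binary.PropositionalEquality using (_≡_; _≢_; refl; cong; trans)
open import Relation.Nullary using (Dec; does; ¬?; _×-dec_; _→-dec_)
open import Relation.Nullary.Decidable using (map′)

-- The set [n] = {1, …, n} is Fin n with its usual order, so that the
-- element i ∈ [n] is represented by the i-th element of Fin n, whose
-- toℕ is i ∸ 1.  A map π : [n] → [n] is the vector (π(1), …, π(n)).

module _ {n : ℕ} where

  IsPermutation : Vec (Fin n) n → Set
  IsPermutation π = Bijective _≡_ _≡_ (lookup π)

  IsDerangement : Vec (Fin n) n → Set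
  IsDerangement π = IsPermutation π × (∀ i → lookup π i ≢ i)

  isPermutation? : (π : Vec (Fin n) n) → Dec (IsPermutation π)
  isPermutation? π = injective? ×-dec surjective?
    where
    injective? : Dec (Injective _≡_ _≡_ (lookup π))
    injective? = map′ (λ inj {x} {y} → inj x y) (λ inj x y → inj)
      (all? λ x → all? λ y → (lookup π x ≟ lookup π y) →-dec (x ≟ y))

    surjective? : Dec (Surjective _≡_ _≡_ (lookup π))
    surjective? = map′
      (λ sur y → map₂ (λ eq z≡x → trans (cong (lookup π) z≡x) eq) (sur y))
      (λ sur y → map₂ (λ eq → eq refl) (sur y))
      (all? λ y → any? λ x → lookup π x ≟ y)

  isDerangement? : (π : Vec (Fin n) n) → Dec (IsDerangement π)
  isDerangement? π = isPermutation? π ×-dec all? λ i → ¬? (lookup π i ≟ i)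

words : (n m : ℕ) → List (Vec (Fin n) m)
words n zero    = [ [] ]
words n (suc m) = cartesianProductWith _∷_ (allFin n) (words n m)

derangements : (n : ℕ) → List (Vec (Fin n) n)
derangements n = filter isDerangement? (words n n)

∈-words : ∀ {n m} (w : Vec (Fin n) m) → w ∈ words n m
∈-words []      = here refl
∈-words (i ∷ w) = ∈-cartesianProductWith⁺ _∷_ (∈-allFin i) (∈-words w)

words-unique : ∀ n m → Unique (words n m)
words-unique n zero    = [] ∷ []
words-unique n (suc m) =
  cartesianProductWith⁺ _∷_ ∷-injective (allFin⁺ n) (words-unique n m)

∈-derangements : ∀ {n} {π : Vec (Fin n) n} → IsDerangement π → π ∈ derangements n
∈-derangements {π = π} d = ∈-filter⁺ isDerangement? (∈-words π) d

derangements-unique : ∀ n → Unique (derangements n)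
derangements-unique n = filter⁺ isDerangement? (words-unique n n)

module _ {n : ℕ} (π : Vec (Fin n) n) where

  IsInversion : Fin n × Fin n → Set
  IsInversion (i , j) = i < j × lookup π i > lookup π j

  isInversion? : (p : Fin n × Fin n) → Dec (IsInversion p)
  isInversion? (i , j) = (i <? j) ×-dec (lookup π j <? lookup π i)

  inv : ℕ
  inv = length (filter isInversion? (cartesianProduct (allFin n) (allFin n)))

  EXCi : Subset n
  EXCi = tabulate λ j → does (j <? lookup π j)

module BigOperators {c ℓ} (R : CommutativeRing c ℓ) where

  open CommutativeRing R using (Carrier; _+_; _*_; 0#; 1#; semiring)
  open import Algebra.Definitions.RawSemiring (Semiring.rawSemiring semiring) public
    using (_^_)

  ∑ : ∀ {a} {A : Set a} → List A → (A → Carrier) → Carrier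
  ∑ as f = foldr _+_ 0# (map f as)

  ∏ : ∀ {a} {A : Set a} → List A → (A → Carrier) → Carrier
  ∏ as f = foldr _*_ 1# (map f as)

  monomial : ∀ {n} → (Fin n → Carrier) → Subset n → Carrier
  monomial x S = ∏ (filter (_∈? S) (allFin _)) x

{-# OPTIONS --safe #-}

-- Up to the condition on fixed points the left-hand side is the Leibniz
-- expansion of det H(x), where H(x) has row i equal to
-- (1, …, 1, 0, xᵢ, …, xᵢ) with 0 on the diagonal; the zero diagonal kills
-- exactly the permutations with a fixed point.  Expand along the first row.
-- Let B(x, q) be H(x) with column q deleted and a column of ones put in
-- front, let x′ be x without its first entry, and let
-- b(x) = ∑_q (-1)^q det B(x, q) with q counted from 1.  Then
--   det H(x) = x₁ b(x′),  det B(x, 1) = det H(x′) + det H(x),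
--   det B(x, q + 1) = det B(x′, q),
-- the last because every other minor has two columns of ones.  Hence
-- det H(x) + b(x) = - (det H(x′) + b(x′)), so det H(x) + b(x) = (-1)ⁿ, and
-- det H(x) = x₁ ((-1)ⁿ⁻¹ - det H(x′)) is the recursion of the right-hand side.
module Submission where

open import Defs
open import Algebra.Bundles using (CommutativeRing; Monoid)
import Algebra.Properties.CommutativeMonoid.Sum
import Algebra.Properties.Monoid.Sum
import Algebra.Properties.Ring
import Algebra.Properties.Semiring.Exp
import Algebra.Properties.Semiring.Sum
open import Data.Bool.Base using (Bool; true; false; if_then_else_; _∧_)
open import Data.Fin.Base using (Fin; zero; suc; toℕ; punchIn; punchOut)
open import Data.Fin.Properties using (_≟_; _<?_; ¬∀⟶∃¬; 0≢1+n; suc-injective; punchIn-injective; punchInᵢ≢i; punchIn-punchOut)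
open import Data.Fin.Subset using (Subset)
open import Data.Fin.Subset.Properties using (_∈?_)
open import Data.List.Base using (List; []; _∷_; [_]; _++_; allFin; applyUpTo; cartesianProduct; cartesianProductWith; filter; foldr; length; map; tabulate; take; upTo)
open import Data.List.Membership.Propositional using (_∈_)
open import Data.List.Membership.Propositional.Properties using (∈-allFin; ∈-cartesianProductWith⁺; ∈-cartesianProductWith⁻; ∈-filter⁺; ∈-filter⁻)
open import Data.List.Membership.Propositional.Properties.WithK using (unique∧set⇒bag)
open import Data.List.Properties using (filter-++; length-++; map-tabulate; map-upTo; take-map)
open import Data.List.Relation.Binary.BagAndSetEquality using (∼bag⇒↭)
open import Data.List.Relation.Binary.Permutation.Propositional using (_↭_; ↭⇒↭ₛ′)
open import Data.List.Relation.Binary.Permutation.Propositional.Properties using (map⁺)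
import Data.List.Relation.Binary.Permutation.Setoid.Properties
open import Data.List.Relation.Unary.All as All using (All; []; _∷_)
open import Data.List.Relation.Unary.AllPairs using ([]; _∷_)
open import Data.List.Relation.Unary.Any using (here)
open import Data.List.Relation.Unary.Unique.Propositional using (Unique)
open import Data.List.Relation.Unary.Unique.Propositional.Properties using (allFin⁺; cartesianProductWith⁺; filter⁺)
open import Data.Nat.Base using (ℕ; zero; suc; _<ᵇ_; _≥_; _∸_)
open import Data.Nat.Properties using (+-0-commutativeMonoid)
open import Data.Product.Base using (_×_; _,_; proj₁; proj₂)
open import Data.Vec.Base as Vec using (Vec; []; _∷_; lookup)
open import Data.Vec.Properties using (lookup-map; lookup∘tabulate; tabulate∘lookup; tabulate-∘; tabulate-cong; ∷-injective)
open import Function.Base using (_∘_; _$_)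
open import Function.Bundles using (mk⇔; mk⤖)
open import Function.Definitions using (Injective; Surjective)
open import Function.Properties.Bijection using (⤖⇒↔)
import Relation.Binary.Reasoning.Setoid
open import Relation.Binary.PropositionalEquality as ≡ using (_≡_; _≢_; cong; cong₂; subst)
open import Relation.Nullary using (Dec; does; yes; no; ¬?; contradiction)
open import Relation.Nullary.Decidable using (decidable-stable)
open import Relation.Unary using (Pred; Decidable)

-- Permutations and inversions

module Permutations where

  open import Data.Nat.Base using (_+_)
  open ≡ using (refl; sym; trans; module ≡-Reasoning)
  open Algebra.Properties.CommutativeMonoid.Sum +-0-commutativeMonoid
    using (sum; sum-cong-≗; sum-permute; sum-replicate-zero)

  map-injective : ∀ {a b} {A : Set a} {B : Set b} {f : A → B} → Injective _≡_ _≡_ f →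
                  ∀ {n} → Injective _≡_ _≡_ (Vec.map {n = n} f)
  map-injective inj {x = []}    {[]}    _  = refl
  map-injective inj {x = _ ∷ _} {_ ∷ _} eq with eq₁ , eq₂ ← ∷-injective eq =
    cong₂ _∷_ (inj eq₁) (map-injective inj eq₂)

  -- One-line notation with first value `p`, the later values being those of `π` shifted past `p`.
  -- The shift is the one by which `minor` renumbers columns, so this recursion on permutations
  -- matches expansion along the first row.
  insert : ∀ {n} → Fin (suc n) → Vec (Fin n) n → Vec (Fin (suc n)) (suc n)
  insert p π = p ∷ Vec.map (punchIn p) π

  permutations : ∀ n → List (Vec (Fin n) n)
  permutations zero    = [ [] ]
  permutations (suc n) = cartesianProductWith insert (allFin (suc n)) (permutations n)

  insert-injective : ∀ {n} {p q : Fin (suc n)} {π ρ : Vec (Fin n) n} →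
                     insert p π ≡ insert q ρ → p ≡ q × π ≡ ρ
  insert-injective eq with refl , eq′ ← ∷-injective eq =
    refl , map-injective (λ {i} {j} → punchIn-injective _ i j) eq′

  permutations-unique : ∀ n → Unique (permutations n)
  permutations-unique zero    = [] ∷ []
  permutations-unique (suc n) =
    cartesianProductWith⁺ insert insert-injective (allFin⁺ (suc n)) (permutations-unique n)

  insert-isPermutation : ∀ {n} (p : Fin (suc n)) {π : Vec (Fin n) n} →
                         IsPermutation π → IsPermutation (insert p π)
  insert-isPermutation p {π} (inj , sur) = inj′ , sur′
    where
    inj′ : Injective _≡_ _≡_ (lookup (insert p π))
    inj′ {zero}  {zero}  _  = refl
    inj′ {zero}  {suc j} eq =
      contradiction (trans (sym (lookup-map j (punchIn p) π)) (sym eq)) (punchInᵢ≢i p _)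
    inj′ {suc i} {zero}  eq =
      contradiction (trans (sym (lookup-map i (punchIn p) π)) eq) (punchInᵢ≢i p _)
    inj′ {suc i} {suc j} eq = cong suc $ inj $ punchIn-injective p _ _ $
      trans (sym (lookup-map i (punchIn p) π)) (trans eq (lookup-map j (punchIn p) π))

    sur′ : Surjective _≡_ _≡_ (lookup (insert p π))
    sur′ y with p ≟ y
    ... | yes refl = zero , λ { refl → refl }
    ... | no p≢y with i , πi≡ ← sur (punchOut p≢y) = suc i , λ { refl →
      trans (lookup-map i (punchIn p) π)
        (trans (cong (punchIn p) (πi≡ refl)) (punchIn-punchOut p≢y)) }

  ∈-permutations⁻ : ∀ {n} {π : Vec (Fin n) n} → π ∈ permutations n → IsPermutation π
  ∈-permutations⁻ {zero}  {[]} _ = (λ { {()} }) , λ ()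
  ∈-permutations⁻ {suc n} π∈
    with p , ρ , _ , ρ∈ , refl ← ∈-cartesianProductWith⁻ insert (allFin (suc n)) (permutations n) π∈
    = insert-isPermutation p (∈-permutations⁻ ρ∈)

  -- Injectivity keeps the first value `p` out of the tail, so `punchOut` can close the gap that `p`
  -- leaves; the result `ρ` is again injective and `insert p ρ` is the given vector.
  ∈-permutations⁺ : ∀ {n} {π : Vec (Fin n) n} → Injective _≡_ _≡_ (lookup π) → π ∈ permutations n
  ∈-permutations⁺ {zero}  {[]}    _   = here refl
  ∈-permutations⁺ {suc n} {p ∷ π} inj =
    subst (_∈ permutations (suc n)) (cong (p ∷_) insert-ρ)
      (∈-cartesianProductWith⁺ insert (∈-allFin p) (∈-permutations⁺ ρ-injective))
    where
    p≢π : ∀ i → p ≢ lookup π i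
    p≢π i eq = 0≢1+n (inj {zero} {suc i} eq)

    ρ : Vec (Fin n) n
    ρ = Vec.tabulate λ i → punchOut (p≢π i)

    insert-ρ : Vec.map (punchIn p) ρ ≡ π
    insert-ρ = begin
      Vec.map (punchIn p) ρ                             ≡⟨ tabulate-∘ (punchIn p) _ ⟨
      Vec.tabulate (λ i → punchIn p (punchOut (p≢π i))) ≡⟨ tabulate-cong (λ i → punchIn-punchOut (p≢π i)) ⟩
      Vec.tabulate (lookup π)                           ≡⟨ tabulate∘lookup π ⟩
      π                                                 ∎
      where open ≡-Reasoning

    ρ-injective : Injective _≡_ _≡_ (lookup ρ)
    ρ-injective {i} {j} eq = suc-injective $ inj {suc i} {suc j} $ begin
      lookup π i                         ≡⟨ cong (λ v → lookup v i) insert-ρ ⟨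
      lookup (Vec.map (punchIn p) ρ) i   ≡⟨ lookup-map i (punchIn p) ρ ⟩
      punchIn p (lookup ρ i)             ≡⟨ cong (punchIn p) eq ⟩
      punchIn p (lookup ρ j)             ≡⟨ lookup-map j (punchIn p) ρ ⟨
      lookup (Vec.map (punchIn p) ρ) j   ≡⟨ cong (λ v → lookup v j) insert-ρ ⟩
      lookup π j                         ∎
      where open ≡-Reasoning

  -- Both lists are free of repetitions and have the same members. This moves the sum from filtered
  -- words to the recursive enumeration.
  derangements-↭ : ∀ n → derangements n ↭ filter isDerangement? (permutations n)
  derangements-↭ n = ∼bag⇒↭ $ unique∧set⇒bag
    (derangements-unique n)
    (filter⁺ isDerangement? (permutations-unique n))
    (mk⇔
      (λ π∈ → let der = proj₂ (∈-filter⁻ isDerangement? {xs = words n n} π∈) in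
              ∈-filter⁺ isDerangement? (∈-permutations⁺ (proj₁ (proj₁ der))) der)
      (λ π∈ → ∈-derangements (proj₂ (∈-filter⁻ isDerangement? {xs = permutations n} π∈))))

  -- Inversion counts as sums of indicators.

  ⟦_⟧ : Bool → ℕ
  ⟦ b ⟧ = if b then 1 else 0

  module _ {a p} {A : Set a} {P : Pred A p} (P? : Decidable P) where

    length-filter-tabulate : ∀ {n} (f : Fin n → A) →
      length (filter P? (tabulate f)) ≡ sum λ i → ⟦ does (P? (f i)) ⟧
    length-filter-tabulate {zero}  f = refl
    length-filter-tabulate {suc n} f with P? (f zero)
    ... | yes _ = cong suc (length-filter-tabulate (f ∘ suc))
    ... | no  _ = length-filter-tabulate (f ∘ suc)

  module _ {a b p} {A : Set a} {B : Set b} {P : Pred (A × B) p} (P? : Decidable P) where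

    length-filter-cartesianProduct : ∀ {m n} (f : Fin m → A) (g : Fin n → B) →
      length (filter P? (cartesianProduct (tabulate f) (tabulate g))) ≡
      sum λ i → sum λ j → ⟦ does (P? (f i , g j)) ⟧
    length-filter-cartesianProduct {zero}  f g = refl
    length-filter-cartesianProduct {suc m} f g = begin
      length (filter P? (row ++ rows))
        ≡⟨ cong length (filter-++ P? row rows) ⟩
      length (filter P? row ++ filter P? rows)
        ≡⟨ length-++ (filter P? row) ⟩
      length (filter P? row) + length (filter P? rows)
        ≡⟨ cong₂ _+_
             (trans (cong (length ∘ filter P?) (map-tabulate g (f zero ,_)))
                    (length-filter-tabulate P? λ j → f zero , g j))
             (length-filter-cartesianProduct (f ∘ suc) g) ⟩
      (sum λ i → sum λ j → ⟦ does (P? (f i , g j)) ⟧) ∎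
      where
      open ≡-Reasoning
      row  = map (f zero ,_) (tabulate g)
      rows = cartesianProduct (tabulate (f ∘ suc)) (tabulate g)

  -- `punchIn p` is strictly increasing, so the inversions among the later entries of `insert p π`
  -- are those of `π`.
  punchIn-<ᵇ : ∀ {n} (p : Fin (suc n)) (i j : Fin n) →
               (toℕ (punchIn p i) <ᵇ toℕ (punchIn p j)) ≡ (toℕ i <ᵇ toℕ j)
  punchIn-<ᵇ zero    i       j       = refl
  punchIn-<ᵇ (suc p) zero    zero    = refl
  punchIn-<ᵇ (suc p) zero    (suc j) = refl
  punchIn-<ᵇ (suc p) (suc i) zero    = refl
  punchIn-<ᵇ (suc p) (suc i) (suc j) = punchIn-<ᵇ p i j

  -- Values below `p` stay fixed, and all others are moved strictly above `p`.
  punchIn-<ᵇ-pivot : ∀ {n} (p : Fin (suc n)) (i : Fin n) →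
                     (toℕ (punchIn p i) <ᵇ toℕ p) ≡ (toℕ i <ᵇ toℕ p)
  punchIn-<ᵇ-pivot zero    i       = refl
  punchIn-<ᵇ-pivot (suc p) zero    = refl
  punchIn-<ᵇ-pivot (suc p) (suc i) = punchIn-<ᵇ-pivot p i

  sum-<ᵇ : ∀ {n} (p : Fin (suc n)) → (sum {n} λ i → ⟦ toℕ i <ᵇ toℕ p ⟧) ≡ toℕ p
  sum-<ᵇ {n}     zero    = sum-replicate-zero n
  sum-<ᵇ {suc n} (suc p) = cong suc (sum-<ᵇ p)

  -- The first entry forms an inversion with each of the `toℕ p` smaller values, all of which come
  -- later; the other inversions are those of `π`.
  inv-insert : ∀ {n} (p : Fin (suc n)) {π : Vec (Fin n) n} → IsPermutation π →
               inv (insert p π) ≡ toℕ p + inv π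
  inv-insert {n} p {π} bij = begin
    inv (insert p π)
      -- Pairs with second position `zero` evaluate to 0, and for the pairs `(zero , suc j)` the
      -- test on positions evaluates to true, so only the two sums below remain.
      ≡⟨ length-filter-cartesianProduct (isInversion? (insert p π)) (λ i → i) (λ j → j) ⟩
    (sum λ j → ⟦ toℕ (lookup (Vec.map (punchIn p) π) j) <ᵇ toℕ p ⟧) +
    (sum λ i → sum λ j → ⟦ (toℕ i <ᵇ toℕ j) ∧
      (toℕ (lookup (Vec.map (punchIn p) π) j) <ᵇ toℕ (lookup (Vec.map (punchIn p) π) i)) ⟧)
      ≡⟨ cong₂ _+_
           (sum-cong-≗ λ j → cong ⟦_⟧ $
             trans (cong (λ k → toℕ k <ᵇ toℕ p) (lookup-map j (punchIn p) π))
                   (punchIn-<ᵇ-pivot p (lookup π j)))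
           (sum-cong-≗ λ i → sum-cong-≗ λ j → cong (λ b → ⟦ (toℕ i <ᵇ toℕ j) ∧ b ⟧) $
             trans (cong₂ (λ k l → toℕ k <ᵇ toℕ l) (lookup-map j (punchIn p) π) (lookup-map i (punchIn p) π))
                   (punchIn-<ᵇ p (lookup π j) (lookup π i))) ⟩
    (sum λ j → ⟦ toℕ (lookup π j) <ᵇ toℕ p ⟧) +
    (sum λ i → sum λ j → ⟦ does (isInversion? π (i , j)) ⟧)
      ≡⟨ cong₂ _+_
           -- Reindexing along the bijection `π` replaces the sum over positions by a sum over all
           -- values.
           (sym (sum-permute (λ k → ⟦ toℕ k <ᵇ toℕ p ⟧) (⤖⇒↔ (mk⤖ bij))))
           (sym (length-filter-cartesianProduct (isInversion? π) (λ i → i) (λ j → j))) ⟩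
    (sum {n} λ k → ⟦ toℕ k <ᵇ toℕ p ⟧) + inv π
      ≡⟨ cong (_+ inv π) (sum-<ᵇ p) ⟩
    toℕ p + inv π ∎
    where open ≡-Reasoning

open Permutations

-- Folds over filtered and tabulated lists.

does-∈? : ∀ {n} (i : Fin n) (S : Subset n) → does (i ∈? S) ≡ lookup S i
does-∈? zero    (true  ∷ S) = ≡.refl
does-∈? zero    (false ∷ S) = ≡.refl
does-∈? (suc i) (_ ∷ S)     = does-∈? i S

module _ {c ℓ} (M : Monoid c ℓ) where
  open Monoid M
  open Algebra.Properties.Monoid.Sum M using (sum)

  foldr-map-tabulate : ∀ {a} {A : Set a} (f : A → Carrier) {n} (g : Fin n → A) →
                       foldr _∙_ ε (map f (tabulate g)) ≡ sum (f ∘ g)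
  foldr-map-tabulate f {zero}  g = ≡.refl
  foldr-map-tabulate f {suc n} g = cong (f (g zero) ∙_) (foldr-map-tabulate f (g ∘ suc))

  foldr-map-filter : ∀ {a p} {A : Set a} {P : Pred A p} (P? : Decidable P) (f : A → Carrier) as →
    foldr _∙_ ε (map f (filter P? as)) ≈ foldr _∙_ ε (map (λ a → if does (P? a) then f a else ε) as)
  foldr-map-filter P? f []       = refl
  foldr-map-filter P? f (a ∷ as) with does (P? a)
  ... | true  = ∙-congˡ (foldr-map-filter P? f as)
  ... | false = trans (foldr-map-filter P? f as) (sym (identityˡ _))

-- Determinants, by Laplace expansion along the first row

module Determinant {c ℓ} (R : CommutativeRing c ℓ) where

  open CommutativeRing R hiding (zero)
  open BigOperators R
  open Algebra.Properties.Ring ring using (-1*x≈-x)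
  open Algebra.Properties.Semiring.Exp semiring using (^-homo-*)
  open Algebra.Properties.Semiring.Sum semiring
    using (sum; sum-cong-≋; *-distribˡ-sum; sum-replicate-zero)
  open Algebra.Properties.CommutativeMonoid.Sum *-commutativeMonoid
    using () renaming (sum to product; sum-cong-≋ to product-cong; sum-remove to product-remove)
  open import Algebra.Solver.Ring.NaturalCoefficients.Default commutativeSemiring
  open Relation.Binary.Reasoning.Setoid setoid

  private variable n : ℕ

  -- Finite sums over lists.

  ∑-cong : ∀ {a} {A : Set a} {f g : A → Carrier} {as} → All (λ a → f a ≈ g a) as → ∑ as f ≈ ∑ as g
  ∑-cong []         = refl
  ∑-cong (eq ∷ eqs) = +-cong eq (∑-cong eqs)

  ∑-distribˡ : ∀ {a} {A : Set a} (y : Carrier) (as : List A) (f : A → Carrier) →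
               ∑ as (λ a → y * f a) ≈ y * ∑ as f
  ∑-distribˡ y []       f = sym (zeroʳ y)
  ∑-distribˡ y (a ∷ as) f = trans (+-congˡ (∑-distribˡ y as f)) (sym (distribˡ y (f a) (∑ as f)))

  ∑-↭ : ∀ {a} {A : Set a} {as bs : List A} (f : A → Carrier) → as ↭ bs → ∑ as f ≈ ∑ bs f
  ∑-↭ f as↭bs = foldr-commMonoid +-isCommutativeMonoid (↭⇒↭ₛ′ isEquivalence (map⁺ f as↭bs))
    where open Data.List.Relation.Binary.Permutation.Setoid.Properties setoid using (foldr-commMonoid)

  ∑-map-++ : ∀ {a b} {A : Set a} {B : Set b} (f : B → Carrier) (g : A → B) as bs →
             ∑ (map g as ++ bs) f ≈ ∑ as (f ∘ g) + ∑ bs f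
  ∑-map-++ f g []       bs = sym (+-identityˡ _)
  ∑-map-++ f g (a ∷ as) bs = trans (+-congˡ (∑-map-++ f g as bs)) (sym (+-assoc _ _ _))

  ∑-cartesianProductWith :
    ∀ {a b d} {A : Set a} {B : Set b} {D : Set d} (f : D → Carrier) (g : A → B → D) as bs →
    ∑ (cartesianProductWith g as bs) f ≈ ∑ as λ a → ∑ bs λ b → f (g a b)
  ∑-cartesianProductWith f g []       bs = refl
  ∑-cartesianProductWith f g (a ∷ as) bs =
    trans (∑-map-++ f (g a) bs _) (+-congˡ (∑-cartesianProductWith f g as bs))

  Matrix : ℕ → Set c
  Matrix n = Fin n → Fin n → Carrier

  minor : Matrix (suc n) → Fin (suc n) → Matrix n
  minor A p i j = A (suc i) (punchIn p j)

  det : Matrix n → Carrier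
  det {zero}  A = 1#
  det {suc n} A = sum λ p → (- 1#) ^ toℕ p * (A zero p * det (minor A p))

  det-cong : {A B : Matrix n} → (∀ i j → A i j ≈ B i j) → det A ≈ det B
  det-cong {zero}  A≈B = refl
  det-cong {suc n} A≈B = sum-cong-≋ λ p →
    *-congˡ {(- 1#) ^ toℕ p} (*-cong (A≈B zero p) (det-cong λ i j → A≈B (suc i) (punchIn p j)))

  x+-1*x≈0 : ∀ x → x + - 1# * x ≈ 0#
  x+-1*x≈0 x = trans (+-congˡ (-1*x≈-x x)) (-‿inverseʳ x)

  sum-zero : {f : Fin n → Carrier} → (∀ i → f i ≈ 0#) → sum f ≈ 0#
  sum-zero {n} f≈0 = trans (sum-cong-≋ f≈0) (sum-replicate-zero n)

  -- Expand along the first row. The first two terms have equal entries, equal minors and opposite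
  -- signs, so they cancel; every later minor keeps the two equal columns and vanishes by induction
  -- on the size.
  det-equalColumns : (A : Matrix (suc (suc n))) → (∀ i → A i zero ≈ A i (suc zero)) → det A ≈ 0#
  det-equalColumns {n} A eq = begin
    1# * (A zero zero * det (minor A zero)) +
    ((- 1#) ^ 1 * (A zero (suc zero) * det (minor A (suc zero))) + sum rest)
      ≈⟨ +-congˡ (+-cong (*-congˡ (*-cong (sym (eq zero)) (det-cong minors≈))) (sum-zero (rest≈0 A eq))) ⟩
    1# * (A zero zero * det (minor A zero)) +
    ((- 1#) ^ 1 * (A zero zero * det (minor A zero)) + 0#)
      ≈⟨ solve 2 (λ s y → con 1 :* y :+ (s :* con 1 :* y :+ con 0) := y :+ s :* y) refl (- 1#) _ ⟩
    A zero zero * det (minor A zero) + - 1# * (A zero zero * det (minor A zero))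
      ≈⟨ x+-1*x≈0 _ ⟩
    0# ∎
    where
    rest : Fin n → Carrier
    rest p = (- 1#) ^ toℕ (suc (suc p)) * (A zero (suc (suc p)) * det (minor A (suc (suc p))))

    minors≈ : ∀ i j → minor A (suc zero) i j ≈ minor A zero i j
    -- The two minors differ only in their first column, which is column 0 of `A` in one and column
    -- 1 in the other.
    minors≈ i zero    = eq (suc i)
    minors≈ i (suc j) = refl

    rest≈0 : ∀ {n} (A : Matrix (suc (suc n))) → (∀ i → A i zero ≈ A i (suc zero)) → ∀ (p : Fin n) →
      (- 1#) ^ toℕ (suc (suc p)) * (A zero (suc (suc p)) * det (minor A (suc (suc p)))) ≈ 0#
    rest≈0 {suc n} A eq p = begin
      (- 1#) ^ toℕ (suc (suc p)) * (A zero (suc (suc p)) * det (minor A (suc (suc p))))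
        -- Deleting a column from the third on leaves columns 0 and 1 in place.
        ≈⟨ *-congˡ (*-congˡ (det-equalColumns (minor A (suc (suc p))) (eq ∘ suc))) ⟩
      (- 1#) ^ toℕ (suc (suc p)) * (A zero (suc (suc p)) * 0#)
        ≈⟨ trans (*-congˡ (zeroʳ _)) (zeroʳ _) ⟩
      0# ∎

  -- The Leibniz expansion.

  leibnizTerm : Matrix n → Vec (Fin n) n → Carrier
  leibnizTerm A π = (- 1#) ^ inv π * product λ i → A i (lookup π i)

  leibnizTerm-insert : (A : Matrix (suc n)) (p : Fin (suc n)) {π : Vec (Fin n) n} → IsPermutation π →
    leibnizTerm A (insert p π) ≈ (- 1#) ^ toℕ p * A zero p * leibnizTerm (minor A p) π
  leibnizTerm-insert A p {π} bij = begin
    (- 1#) ^ inv (insert p π) * (A zero p * product λ i → A (suc i) (lookup (Vec.map (punchIn p) π) i))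
      ≈⟨ *-cong
           (trans (reflexive (cong ((- 1#) ^_) (inv-insert p bij))) (^-homo-* (- 1#) (toℕ p) (inv π)))
           (*-congˡ (product-cong λ i → reflexive (cong (A (suc i)) (lookup-map i (punchIn p) π)))) ⟩
    (- 1#) ^ toℕ p * (- 1#) ^ inv π * (A zero p * product λ i → minor A p i (lookup π i))
      ≈⟨ solve 4 (λ s t a b → s :* t :* (a :* b) := s :* a :* (t :* b)) refl _ _ _ _ ⟩
    (- 1#) ^ toℕ p * A zero p * leibnizTerm (minor A p) π ∎

  -- Grouping the permutations by their first value `p` gives the Laplace terms: by `inv-insert`,
  -- the sign of `insert p π` is that of `π` times the cofactor sign.
  leibniz : ∀ n (A : Matrix n) → ∑ (permutations n) (leibnizTerm A) ≈ det A
  leibniz zero    A = solve 0 (con 1 :* con 1 :+ con 0 := con 1) refl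
  leibniz (suc n) A = begin
    ∑ (permutations (suc n)) (leibnizTerm A)
      ≈⟨ ∑-cartesianProductWith (leibnizTerm A) insert (allFin (suc n)) (permutations n) ⟩
    ∑ (allFin (suc n)) (λ p → ∑ (permutations n) λ π → leibnizTerm A (insert p π))
      ≡⟨ foldr-map-tabulate +-monoid _ (λ (p : Fin (suc n)) → p) ⟩
    (sum λ p → ∑ (permutations n) λ π → leibnizTerm A (insert p π))
      ≈⟨ sum-cong-≋ expand ⟩
    det A ∎
    where
    expand : ∀ p → (∑ (permutations n) λ π → leibnizTerm A (insert p π)) ≈
                   (- 1#) ^ toℕ p * (A zero p * det (minor A p))
    expand p = begin
      ∑ (permutations n) (λ π → leibnizTerm A (insert p π))
        ≈⟨ ∑-cong (All.tabulate λ π∈ → leibnizTerm-insert A p (∈-permutations⁻ π∈)) ⟩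
      ∑ (permutations n) (λ π → (- 1#) ^ toℕ p * A zero p * leibnizTerm (minor A p) π)
        ≈⟨ ∑-distribˡ _ (permutations n) _ ⟩
      (- 1#) ^ toℕ p * A zero p * ∑ (permutations n) (leibnizTerm (minor A p))
        ≈⟨ *-congˡ (leibniz n (minor A p)) ⟩
      (- 1#) ^ toℕ p * A zero p * det (minor A p)
        ≈⟨ *-assoc _ _ _ ⟩
      (- 1#) ^ toℕ p * (A zero p * det (minor A p)) ∎

  -- The matrices H(x) and B(x, q)

  hollow : (Fin n → Carrier) → Matrix n
  hollow x zero    zero    = 0#
  hollow x zero    (suc j) = x zero
  hollow x (suc i) zero    = 1#
  hollow x (suc i) (suc j) = hollow (x ∘ suc) i j

  hollow-diagonal : (x : Fin n → Carrier) (i : Fin n) → hollow x i i ≡ 0#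
  hollow-diagonal x zero    = ≡.refl
  hollow-diagonal x (suc i) = hollow-diagonal (x ∘ suc) i

  -- The test is the one in `EXCi`: position `i` has weight `x i` exactly when its value exceeds it.
  hollow-offDiagonal : (x : Fin n → Carrier) (i j : Fin n) → j ≢ i →
                       hollow x i j ≡ (if does (i <? j) then x i else 1#)
  hollow-offDiagonal x zero    zero    j≢i = contradiction ≡.refl j≢i
  hollow-offDiagonal x zero    (suc j) _   = ≡.refl
  hollow-offDiagonal x (suc i) zero    _   = ≡.refl
  hollow-offDiagonal x (suc i) (suc j) j≢i = hollow-offDiagonal (x ∘ suc) i j (j≢i ∘ cong suc)

  -- The derangement sum as a determinant.

  monomial-EXCi : (x : Fin n → Carrier) (π : Vec (Fin n) n) → (∀ i → lookup π i ≢ i) →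
                  monomial x (EXCi π) ≈ product λ i → hollow x i (lookup π i)
  monomial-EXCi {n} x π π≢ = begin
    ∏ (filter (_∈? EXCi π) (allFin n)) x
      ≈⟨ foldr-map-filter *-monoid (_∈? EXCi π) x (allFin n) ⟩
    ∏ (allFin n) (λ i → if does (i ∈? EXCi π) then x i else 1#)
      ≡⟨ foldr-map-tabulate *-monoid _ (λ (i : Fin n) → i) ⟩
    (product λ i → if does (i ∈? EXCi π) then x i else 1#)
      ≈⟨ product-cong (λ i → reflexive (≡.trans
           (cong (if_then x i else 1#) (≡.trans (does-∈? i (EXCi π)) (lookup∘tabulate _ i)))
           (≡.sym (hollow-offDiagonal x i (lookup π i) (π≢ i))))) ⟩
    (product λ i → hollow x i (lookup π i)) ∎

  product-zero : (f : Fin n → Carrier) (i : Fin n) → f i ≈ 0# → product f ≈ 0#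
  product-zero {suc n} f i fi≈0 = trans (product-remove {i = i} f) (trans (*-congʳ fi≈0) (zeroˡ _))

  ∑-derangements : (x : Fin n → Carrier) →
    ∑ (derangements n) (λ π → (- 1#) ^ inv π * monomial x (EXCi π)) ≈ det (hollow x)
  ∑-derangements {n} x = begin
    ∑ (derangements n) term
      ≈⟨ ∑-↭ term (derangements-↭ n) ⟩
    ∑ (filter isDerangement? (permutations n)) term
      ≈⟨ foldr-map-filter +-monoid isDerangement? term (permutations n) ⟩
    ∑ (permutations n) (λ π → if does (isDerangement? π) then term π else 0#)
      ≈⟨ ∑-cong (All.tabulate λ {π} π∈ → term≈ π (∈-permutations⁻ π∈) (isDerangement? π)) ⟩
    ∑ (permutations n) (leibnizTerm (hollow x))
      ≈⟨ leibniz n (hollow x) ⟩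
    det (hollow x) ∎
    where
    term : Vec (Fin n) n → Carrier
    term π = (- 1#) ^ inv π * monomial x (EXCi π)

    term≈ : ∀ π → IsPermutation π → (d : Dec (IsDerangement π)) →
            (if does d then term π else 0#) ≈ leibnizTerm (hollow x) π
    term≈ π bij (yes (_ , π≢)) = *-congˡ (monomial-EXCi x π π≢)
    -- A permutation that is not a derangement has a fixed point `i`, found by finite search, and
    -- the factor `hollow x i i` makes its Leibniz term 0.
    term≈ π bij (no ¬der)
      with i , ¬¬fixed ← ¬∀⟶∃¬ n _ (λ i → ¬? (lookup π i ≟ i)) (λ π≢ → ¬der (bij , π≢)) =
      sym (trans (*-congˡ (product-zero _ i (reflexive (≡.trans (cong (hollow x i) fixed) (hollow-diagonal x i)))))
                 (zeroʳ _))
      where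
      fixed : lookup π i ≡ i
      fixed = decidable-stable (lookup π i ≟ i) ¬¬fixed

  -- Recursions for the hollow and bordered determinants.

  bordered : (Fin n → Carrier) → Fin n → Matrix n
  bordered x q i zero    = 1#
  bordered {suc n} x q i (suc j) = hollow x i (punchIn q j)

  -- This is b(x). Here `q` counts from 0, hence the exponent `suc (toℕ q)`, which is also the
  -- cofactor sign of column `suc q` in a matrix one size larger.
  borderedSum : (Fin n → Carrier) → Carrier
  borderedSum x = sum λ q → (- 1#) ^ suc (toℕ q) * det (bordered x q)

  -- Evaluates the part of a first-row expansion past column 0 when all entries there equal `y` and
  -- the minors are bordered matrices; it serves both `hollow x` and `bordered x zero`.
  sum-bordered : (y : Carrier) (x : Fin n → Carrier) (M : Fin n → Matrix n) →
    (∀ q i j → M q i j ≈ bordered x q i j) →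
    (sum λ q → (- 1#) ^ suc (toℕ q) * (y * det (M q))) ≈ y * borderedSum x
  sum-bordered {n} y x M M≈ = begin
    (sum λ q → (- 1#) ^ suc (toℕ q) * (y * det (M q)))
      ≈⟨ sum-cong-≋ (λ q → trans (*-congˡ (*-congˡ (det-cong (M≈ q))))
           (solve 3 (λ s y d → s :* (y :* d) := y :* (s :* d)) refl _ _ _)) ⟩
    (sum λ q → y * ((- 1#) ^ suc (toℕ q) * det (bordered x q)))
      ≈⟨ *-distribˡ-sum {n} y _ ⟨
    y * borderedSum x ∎

  -- The first row is (0, x₁, ..., x₁). Deleting it together with column `suc q` keeps the ones of
  -- column 0 as the border of `hollow (x ∘ suc)` without its column `q`.
  det-hollow : (x : Fin (suc n) → Carrier) → det (hollow x) ≈ x zero * borderedSum (x ∘ suc)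
  det-hollow {n} x = begin
    1# * (0# * det (minor (hollow x) zero)) + _
      ≈⟨ +-cong (solve 1 (λ d → con 1 :* (con 0 :* d) := con 0) refl _)
                (sum-bordered (x zero) (x ∘ suc) (λ q → minor (hollow x) (suc q)) minor≈) ⟩
    0# + x zero * borderedSum (x ∘ suc)
      ≈⟨ +-identityˡ _ ⟩
    x zero * borderedSum (x ∘ suc) ∎
    where
    minor≈ : ∀ q i j → minor (hollow x) (suc q) i j ≈ bordered (x ∘ suc) q i j
    minor≈ q i zero    = refl
    minor≈ q i (suc j) = refl

  -- This matrix is `hollow x` with its first column replaced by ones. The new corner entry
  -- contributes `det (hollow (x ∘ suc))`, and the remaining terms are those of `det (hollow x)`.
  det-bordered-zero : (x : Fin (suc n) → Carrier) →
    det (bordered x zero) ≈ det (hollow (x ∘ suc)) + det (hollow x)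
  det-bordered-zero x = +-cong
    (solve 1 (λ d → con 1 :* (con 1 :* d) := d) refl _)
    (trans (sum-bordered (x zero) (x ∘ suc) (λ q → minor (bordered x zero) (suc q)) minor≈)
           (sym (det-hollow x)))
    where
    minor≈ : ∀ q i j → minor (bordered x zero) (suc q) i j ≈ bordered (x ∘ suc) q i j
    minor≈ q i zero    = refl
    minor≈ q i (suc j) = refl

  -- The first row is (1, 0, x₁, ..., x₁). Below it the border and column 0 of `hollow x` both
  -- consist of ones. So column 0 gives the smaller bordered matrix, column 1 has coefficient 0, and
  -- every later minor has two equal columns.
  det-bordered-suc : (x : Fin (suc n) → Carrier) (q : Fin n) →
    det (bordered x (suc q)) ≈ det (bordered (x ∘ suc) q)
  det-bordered-suc {suc n} x q = begin
    1# * (1# * det (minor B zero)) +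
    ((- 1#) ^ 1 * (0# * det (minor B (suc zero))) + _)
      ≈⟨ +-cong (*-congˡ (*-congˡ (det-cong minor≈))) (+-congˡ (sum-zero (rest≈0 x q))) ⟩
    1# * (1# * det (bordered (x ∘ suc) q)) + ((- 1#) ^ 1 * (0# * det (minor B (suc zero))) + 0#)
      ≈⟨ solve 3 (λ d s e → con 1 :* (con 1 :* d) :+ (s :* (con 0 :* e) :+ con 0) := d) refl _ _ _ ⟩
    det (bordered (x ∘ suc) q) ∎
    where
    B = bordered x (suc q)

    minor≈ : ∀ i j → minor B zero i j ≈ bordered (x ∘ suc) q i j
    minor≈ i zero    = refl
    minor≈ i (suc j) = refl

    rest≈0 : ∀ {n} (x : Fin (suc (suc n)) → Carrier) (q : Fin (suc n)) (r : Fin n) →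
      (- 1#) ^ suc (suc (toℕ r)) *
        (bordered x (suc q) zero (suc (suc r)) * det (minor (bordered x (suc q)) (suc (suc r)))) ≈ 0#
    rest≈0 {suc n} x q r = trans
      (*-congˡ (trans (*-congˡ (det-equalColumns (minor (bordered x (suc q)) (suc (suc r))) λ i → refl)) (zeroʳ _)))
      (zeroʳ _)

  -- The term `q = zero` of `borderedSum x` is minus the sum of `det (hollow (x ∘ suc))` and
  -- `det (hollow x)`, and its second part cancels the leading summand. The other terms add up to
  -- minus `borderedSum (x ∘ suc)`.
  det-hollow+borderedSum : (x : Fin n → Carrier) → det (hollow x) + borderedSum x ≈ (- 1#) ^ n
  -- The empty determinant is 1 and the empty sum is 0.
  det-hollow+borderedSum {zero}  x = +-identityʳ 1#
  det-hollow+borderedSum {suc n} x = begin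
    det (hollow x) + ((- 1#) ^ 1 * det (bordered x zero) +
      sum λ q → (- 1#) ^ suc (suc (toℕ q)) * det (bordered x (suc q)))
      ≈⟨ +-congˡ (+-cong (*-congˡ (det-bordered-zero x)) (trans
           (sum-cong-≋ λ q → trans (*-assoc _ _ _) (*-congˡ (*-congˡ (det-bordered-suc x q))))
           (sym (*-distribˡ-sum {n} (- 1#) _)))) ⟩
    det (hollow x) + ((- 1#) ^ 1 * (det (hollow (x ∘ suc)) + det (hollow x)) +
      - 1# * borderedSum (x ∘ suc))
      ≈⟨ solve 4 (λ s d e b → d :+ (s :* con 1 :* (e :+ d) :+ s :* b) := s :* (e :+ b) :+ (d :+ s :* d))
           refl (- 1#) _ _ _ ⟩
    - 1# * (det (hollow (x ∘ suc)) + borderedSum (x ∘ suc)) + (det (hollow x) + - 1# * det (hollow x))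
      ≈⟨ +-cong (*-congˡ (det-hollow+borderedSum (x ∘ suc))) (x+-1*x≈0 _) ⟩
    (- 1#) ^ suc n + 0#
      ≈⟨ +-identityʳ _ ⟩
    (- 1#) ^ suc n ∎

  -- Sums of prefix products and their recursion.

  prefixSum : (Fin (suc n) → Carrier) → Carrier
  prefixSum {n} x = ∑ (map suc (upTo n)) λ j → ∏ (take j (allFin (suc n))) x

  ∑-applyUpTo : (f : ℕ → Carrier) (g : ℕ → ℕ) → ∀ n → ∑ (applyUpTo g n) f ≡ sum {n} λ k → f (g (toℕ k))
  ∑-applyUpTo f g zero    = ≡.refl
  ∑-applyUpTo f g (suc n) = cong (f (g 0) +_) (∑-applyUpTo f (g ∘ suc) n)

  prefixSum≡ : (x : Fin (suc n) → Carrier) →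
    prefixSum x ≡ sum {n} λ k → ∏ (take (suc (toℕ k)) (allFin (suc n))) x
  prefixSum≡ {n} x = ≡.trans
    (cong (λ js → ∑ js λ j → ∏ (take j (allFin (suc n))) x) (map-upTo suc n))
    (∑-applyUpTo _ suc n)

  ∏-map : ∀ {a b} {A : Set a} {B : Set b} (f : A → B) as (x : B → Carrier) → ∏ (map f as) x ≡ ∏ as (x ∘ f)
  ∏-map f []       x = ≡.refl
  ∏-map f (a ∷ as) x = cong (x (f a) *_) (∏-map f as x)

  ∏-take-suc : ∀ j (x : Fin (suc n) → Carrier) →
    ∏ (take (suc j) (allFin (suc n))) x ≡ x zero * ∏ (take j (allFin n)) (x ∘ suc)
  ∏-take-suc {n} j x = cong (x zero *_) $ ≡.trans
    (cong (λ is → ∏ is x) (≡.trans (cong (take j) (≡.sym (map-tabulate (λ i → i) suc))) (take-map j (allFin n))))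
    (∏-map suc (take j (allFin n)) x)

  -- Every nonempty prefix product contains `x zero`; taking it out leaves the prefixes of
  -- `x ∘ suc`, now including the empty one.
  prefixSum-suc : (x : Fin (suc (suc n)) → Carrier) →
                  prefixSum x ≈ x zero * (1# + prefixSum (x ∘ suc))
  prefixSum-suc {n} x = begin
    prefixSum x
      ≡⟨ prefixSum≡ x ⟩
    (sum {suc n} λ k → ∏ (take (suc (toℕ k)) (allFin (suc (suc n)))) x)
      ≈⟨ sum-cong-≋ {suc n} (λ k → reflexive (∏-take-suc (toℕ k) x)) ⟩
    (sum {suc n} λ k → x zero * ∏ (take (toℕ k) (allFin (suc n))) (x ∘ suc))
      -- The index `k = 0` gives the empty product, which is the `1#` split off below.
      ≈⟨ *-distribˡ-sum {suc n} (x zero) (λ k → ∏ (take (toℕ k) (allFin (suc n))) (x ∘ suc)) ⟨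
    x zero * (1# + sum {n} λ k → ∏ (take (suc (toℕ k)) (allFin (suc n))) (x ∘ suc))
      ≡⟨ cong (λ s → x zero * (1# + s)) (prefixSum≡ (x ∘ suc)) ⟨
    x zero * (1# + prefixSum (x ∘ suc)) ∎

  det-hollow≈prefixSum : ∀ n (x : Fin (suc n) → Carrier) → det (hollow x) ≈ (- 1#) ^ n * prefixSum x
  -- With one variable both sides are multiples of an empty sum.
  det-hollow≈prefixSum zero    x = trans (det-hollow x) (trans (zeroʳ _) (sym (zeroʳ _)))
  det-hollow≈prefixSum (suc n) x = begin
    det (hollow x)
      ≈⟨ det-hollow x ⟩
    x zero * borderedSum (x ∘ suc)
      -- The value of `det (hollow (x ∘ suc)) + borderedSum (x ∘ suc)` is known, and the induction
      -- hypothesis gives its first summand, so `borderedSum (x ∘ suc)` is the difference.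
      ≈⟨ *-congˡ (solveFor (trans (+-congʳ (sym (det-hollow≈prefixSum n (x ∘ suc)))) (det-hollow+borderedSum (x ∘ suc)))) ⟩
    x zero * ((- 1#) ^ suc n + - 1# * ((- 1#) ^ n * prefixSum (x ∘ suc)))
      ≈⟨ solve 4 (λ y s t p → y :* (s :* t :+ s :* (t :* p)) := s :* t :* (y :* (con 1 :+ p))) refl (x zero) (- 1#) _ _ ⟩
    (- 1#) ^ suc n * (x zero * (1# + prefixSum (x ∘ suc)))
      ≈⟨ *-congˡ (prefixSum-suc x) ⟨
    (- 1#) ^ suc n * prefixSum x ∎
    where
    solveFor : ∀ {d b e} → d + b ≈ e → b ≈ e + - 1# * d
    solveFor {d} {b} {e} d+b≈e = begin
      b                      ≈⟨ +-identityʳ b ⟨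
      b + 0#                 ≈⟨ +-congˡ (x+-1*x≈0 d) ⟨
      b + (d + - 1# * d)     ≈⟨ solve 3 (λ b d m → b :+ (d :+ m) := (d :+ b) :+ m) refl b d _ ⟩
      (d + b) + - 1# * d     ≈⟨ +-congʳ d+b≈e ⟩
      e + - 1# * d           ∎

theorem31 : ∀ {c ℓ} (R : CommutativeRing c ℓ) →
    let open CommutativeRing R
        open BigOperators R in
    (n : ℕ) → n ≥ 1 → (x : Fin n → Carrier) →
    ∑ (derangements n) (λ π → (- 1#) ^ inv π * monomial x (EXCi π))
      ≈ (- 1#) ^ (n ∸ 1) * ∑ (map suc (upTo (n ∸ 1))) (λ j → ∏ (take j (allFin n)) x)
theorem31 R (suc n) _ x = trans (∑-derangements x) (det-hollow≈prefixSum n x)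
  where
  open CommutativeRing R using (trans)
  open Determinant R
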